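{- With $t_m=m(m+1)/2$ denoting the $m$-th triangular number, the following hold. \begin{itemize} \item $g(t_n,t_{n+1},t_{n+2};3)=\frac{(5 n+3)(n+1)(n+2)}{4}-1$ if $n\ge 3$ is odd, and $=\frac{(5 n+6)(n+1)(n+2)}{4}-1$ if $n\ge 6$ is even. \item For $n=5$ and for all $n\ge 7$: $g(t_n,t_{n+1},t_{n+2};4)=\frac{3 n(n+1)(n+2)}{2}-1$. \item For $n=6$ and for all $n\ge 8$: $g(t_n,t_{n+1},t_{n+2};5)=\frac{3(n+1)^2(n+2)}{2}-1$. \item $g(t_n,t_{n+1},t_{n+2};6)=\frac{(7 n-3)(n+1)(n+2)}{4}-1$ if $n\ge 11$ is odd, and $=\frac{7 n(n+1)(n+2)}{4}-1$ if $n\ge 8$ is even. \item $g(t_n,t_{n+1},t_{n+2};7)=\frac{(7 n+3)(n+1)(n+2)}{4}-1$ if $n\ge 5$ is odd, and $=\frac{(7 n+6)(n+1)(n+2)}{4}-1$ if $n\ge 6$ is even. \item $g(t_n,t_{n+1},t_{n+2};8)=\frac{(7 n+9)(n+1)(n+2)}{4}-1$ if $n\ge 9$ is odd, and $=\frac{(7 n+12)(n+1)(n+2)}{4}-1$ if $n\ge 12$ is even. \item For $n=11$ and for all $n\ge 13$: $g(t_n,t_{n+1},t_{n+2};9)=2 n(n+1)(n+2)-1$. \item For $n=3$, $n=4$ and for all $n\ge 8$: $g(t_n,t_{n+1},t_{n+2};10)=\frac{(4 n+3)(n+1)(n+2)}{2}-1$. \end{itemize}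
   Context: For positive integers $a_1,\dots,a_k$ with $\gcd(a_1,\dots,a_k)=1$ and an integer $N$, let $d(N;a_1,\dots,a_k)$ denote the number of $k$-tuples $(x_1,\dots,x_k)$ of nonnegative integers with $a_1x_1+\cdots+a_kx_k=N$. For a nonnegative integer $q$, $g(a_1,\dots,a_k;q)$ denotes the largest integer $N$ such that $d(N;a_1,\dots,a_k)\le q$. It is known that $\gcd(t_n,t_{n+1},t_{n+2})=1$. -}

module Defs where

open import Data.Nat using (ℕ; zero; suc; _+_; _*_; _∸_; _≤_; _<_; _≟_)
open import Data.Nat.DivMod using (_/_)
open import Data.List using (List; length; filter; map; upTo)
open import Data.Nat.ListAction using (sum)
open import Data.Product using (_×_)

t : ℕ → ℕ
t m = (m * suc m) / 2

-- d(N; a,b,c) : number of triples (x,y,z) of nonnegative integers with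
-- a x + b y + c z = N.  Intended for positive a, b, c: then every solution has
-- x, y, z ≤ N, so enumerating 0..N for each coordinate counts all solutions.
d : ℕ → ℕ → ℕ → ℕ → ℕ
d N a b c =
  sum (map (λ x →
    sum (map (λ y →
      length (filter (λ z → a * x + b * y + c * z ≟ N) (upTo (suc N))))
    (upTo (suc N))))
  (upTo (suc N)))

-- "G = g(a,b,c;q)": G is the largest integer N with d(N;a,b,c) ≤ q.
-- (Every integer above a nonnegative G is a natural number, so quantifying
-- over ℕ for N > G is the same as quantifying over ℤ.)
IsG : ℕ → ℕ → ℕ → ℕ → ℕ → Set
IsG a b c q G = (d G a b c ≤ q) × (∀ N → G < N → q < d N a b c)

gT : ℕ → ℕ → ℕ → Set
gT n q G = IsG (t n) (t (suc n)) (t (suc (suc n))) q G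

{-# OPTIONS --safe #-}
module Submission where

-- Put a = t n, b = t (n + 1), c = t (n + 2).  There are r, s, p, u with a = r s,
-- b = p s, c = p u and a + c = 1 + 2 b; for n = 2 k they are k, 2 k + 1, k + 1,
-- 2 k + 3, and for n = 2 k + 1 they are 2 k + 1, k + 1, 2 k + 3, k + 2.  The
-- relations between a, b, c are then spanned by (p , - r , 0) and (0 , - u , s),
-- so every N is a x₀ + b y₀ + c z₀ for unique x₀ < p, z₀ < s and integer y₀, its
-- solutions are (x₀ + p i , y₀ - r i - u j , z₀ + s j), and d N is the number of
-- (i , j) with r i + u j ≤ y₀.  If this number first exceeds q at y₀ = Z, then
-- G = a (p - 1) + b (Z - 1) + c (s - 1) = b (r + u + Z - 3) - 1.  In all cases
-- at hand Z is linear in k, and a threshold valid for all large k is verified by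
-- comparing linear forms at finitely many (i , j).

open import Defs
open import Data.Bool using (true; false)
open import Data.Nat using (ℕ; zero; suc; _+_; _*_; _∸_; _≤_; _<_; z≤n; s≤s; s≤s⁻¹;
  _≟_; _≤?_; _<?_; NonZero; >-nonZero; >-nonZero⁻¹)
open import Data.Nat.DivMod using (_/_; _%_; m≡m%n+[m/n]*n; m%n<n; m*n/n≡m; n/1≡n)
open import Data.Nat.Divisibility
open import Data.Nat.ListAction using (sum)
open import Data.Nat.Properties
open import Data.Nat.Tactic.RingSolver using (solve; solve-∀)
open import Data.List using (List; []; _∷_; _++_; length; filter; map; upTo; cartesianProduct)
open import Data.List.Membership.Propositional using (_∈_)
open import Data.List.Membership.Propositional.Properties
open import Data.List.Properties using (length-++; length-map; filter-++)
open import Data.List.Relation.Binary.Subset.Propositional using (_⊆_)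
open import Data.List.Relation.Unary.All as All using (All)
open import Data.List.Relation.Unary.AllPairs using ([]; _∷_)
open import Data.List.Relation.Unary.Any using (here; there)
open import Data.List.Relation.Unary.Unique.Propositional using (Unique)
open import Data.List.Relation.Unary.Unique.Propositional.Properties using (map⁺; filter⁺; cartesianProduct⁺; upTo⁺)
open import Data.Product using (_×_; _,_; proj₁; proj₂)
open import Data.Sum using (_⊎_; inj₁; inj₂; [_,_]′)
open import Function using (_∘_)
open import Relation.Binary.PropositionalEquality using (_≡_; refl; sym; trans; cong; cong₂; subst; subst₂;
  module ≡-Reasoning)
open import Relation.Nullary using (¬_; Dec; does; contradiction)
open import Relation.Nullary.Decidable using (True; toWitness; ¬?; _×-dec_)
open import Relation.Unary using (Decidable)

-- Counting by lists.

-- Induction on `xs`: deleting one occurrence of the head from `ys` keeps the tail inside, because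
-- the head does not recur. Both bounds on `d` rest on this comparison.
unique-⊆⇒length-≤ : ∀ {A : Set} {xs ys : List A} → Unique xs → xs ⊆ ys → length xs ≤ length ys
unique-⊆⇒length-≤ [] _ = z≤n
unique-⊆⇒length-≤ {xs = x ∷ xs} (x∉xs ∷ uniq) xs⊆ys
  with as , bs , refl ← ∈-∃++ (xs⊆ys (here refl)) = begin
    suc (length xs)               ≤⟨ s≤s (unique-⊆⇒length-≤ uniq xs⊆rest) ⟩
    suc (length (as ++ bs))       ≡⟨ cong suc (length-++ as) ⟩
    suc (length as + length bs)   ≡⟨ +-suc (length as) (length bs) ⟨
    length as + suc (length bs)   ≡⟨ length-++ as ⟨
    length (as ++ x ∷ bs)         ∎
  where
  open ≤-Reasoning
  xs⊆rest : xs ⊆ as ++ bs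
  xs⊆rest v∈xs with ∈-++⁻ as (xs⊆ys (there v∈xs))
  ... | inj₁ v∈as           = ∈-++⁺ˡ v∈as
  ... | inj₂ (here refl)    = contradiction refl (All.lookup x∉xs v∈xs)
  ... | inj₂ (there v∈bs)   = ∈-++⁺ʳ as v∈bs

length-filter-map : ∀ {A B : Set} {P : B → Set} (P? : Decidable P) (f : A → B) xs →
  length (filter P? (map f xs)) ≡ length (filter (P? ∘ f) xs)
length-filter-map P? f [] = refl
length-filter-map P? f (x ∷ xs) with does (P? (f x))
... | true  = cong suc (length-filter-map P? f xs)
... | false = length-filter-map P? f xs

-- Applied twice, this turns the iterated sum in `d` into the length of one filtered list of
-- triples.
length-filter-cartesianProduct : ∀ {A B : Set} {P : A × B → Set} (P? : Decidable P) xs ys →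
  length (filter P? (cartesianProduct xs ys)) ≡
  sum (map (λ x → length (filter (λ y → P? (x , y)) ys)) xs)
length-filter-cartesianProduct P? []       ys = refl
length-filter-cartesianProduct P? (x ∷ xs) ys = begin
  length (filter P? (map (x ,_) ys ++ cartesianProduct xs ys))
    ≡⟨ cong length (filter-++ P? (map (x ,_) ys) _) ⟩
  length (filter P? (map (x ,_) ys) ++ filter P? (cartesianProduct xs ys))
    ≡⟨ length-++ (filter P? (map (x ,_) ys)) ⟩
  length (filter P? (map (x ,_) ys)) + length (filter P? (cartesianProduct xs ys))
    ≡⟨ cong₂ _+_ (length-filter-map P? (x ,_) ys) (length-filter-cartesianProduct P? xs ys) ⟩
  _ ∎
  where open ≡-Reasoning

sum-map-cong : ∀ {A : Set} {f g : A → ℕ} → (∀ x → f x ≡ g x) → ∀ xs → sum (map f xs) ≡ sum (map g xs)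
sum-map-cong f≗g []       = refl
sum-map-cong f≗g (x ∷ xs) = cong₂ _+_ (f≗g x) (sum-map-cong f≗g xs)

-- The list of solutions behind `d`.

IsSolution : ℕ → ℕ → ℕ → ℕ → ℕ × ℕ × ℕ → Set
IsSolution N a b c (x , y , z) = a * x + b * y + c * z ≡ N

isSolution? : ∀ N a b c → Decidable (IsSolution N a b c)
isSolution? N a b c (x , y , z) = a * x + b * y + c * z ≟ N

triples : ℕ → List (ℕ × ℕ × ℕ)
triples m = cartesianProduct (upTo m) (cartesianProduct (upTo m) (upTo m))

solutions : ℕ → ℕ → ℕ → ℕ → List (ℕ × ℕ × ℕ)
solutions N a b c = filter (isSolution? N a b c) (triples (suc N))

length-solutions : ∀ N a b c → length (solutions N a b c) ≡ d N a b c
length-solutions N a b c =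
  trans (length-filter-cartesianProduct (isSolution? N a b c) range (cartesianProduct range range))
        (sum-map-cong
          (λ x → length-filter-cartesianProduct (λ yz → isSolution? N a b c (x , yz)) range range)
          range)
  where range = upTo (suc N)

unique-solutions : ∀ N a b c → Unique (solutions N a b c)
unique-solutions N a b c = filter⁺ (isSolution? N a b c)
  (cartesianProduct⁺ (upTo⁺ (suc N)) (cartesianProduct⁺ (upTo⁺ (suc N)) (upTo⁺ (suc N))))

-- Positive coefficients bound every coordinate of a solution by `N`, so the enumerated cube misses
-- none.
∈-solutions⁺ : ∀ N a b c .{{_ : NonZero a}} .{{_ : NonZero b}} .{{_ : NonZero c}} {v} →
  IsSolution N a b c v → v ∈ solutions N a b c
∈-solutions⁺ N a b c {x , y , z} eq = ∈-filter⁺ (isSolution? N a b c)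
  (∈-cartesianProduct⁺ (∈-upTo⁺ (s≤s x≤N))
    (∈-cartesianProduct⁺ (∈-upTo⁺ (s≤s y≤N)) (∈-upTo⁺ (s≤s z≤N)))) eq
  where
  open ≤-Reasoning
  x≤N : x ≤ N
  x≤N = begin
    x                         ≤⟨ m≤n*m x a ⟩
    a * x                     ≤⟨ m≤m+n _ _ ⟩
    a * x + b * y             ≤⟨ m≤m+n _ _ ⟩
    a * x + b * y + c * z     ≡⟨ eq ⟩
    N                         ∎
  y≤N : y ≤ N
  y≤N = begin
    y                         ≤⟨ m≤n*m y b ⟩
    b * y                     ≤⟨ m≤n+m _ _ ⟩
    a * x + b * y             ≤⟨ m≤m+n _ _ ⟩
    a * x + b * y + c * z     ≡⟨ eq ⟩
    N                         ∎
  z≤N : z ≤ N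
  z≤N = begin
    z                         ≤⟨ m≤n*m z c ⟩
    c * z                     ≤⟨ m≤n+m _ _ ⟩
    a * x + b * y + c * z     ≡⟨ eq ⟩
    N                         ∎

-- Jumps of the lattice point count.

-- q is passed exactly at Z by the number of (i , j) with r i + u j ≤ y₀, as y₀ grows.
record Jump (r u Z q : ℕ) : Set where
  field
    below          : List (ℕ × ℕ)
    below-complete : ∀ i j → r * i + u * j < Z → (i , j) ∈ below
    below-length   : length below ≤ q
    upto           : List (ℕ × ℕ)
    upto-unique    : Unique upto
    upto-sound     : ∀ {i j} → (i , j) ∈ upto → r * i + u * j ≤ Z
    upto-length    : q < length upto

-- Divisibility from the relation a + c = 1 + 2 b.

-- A Bézout identity without subtraction: a number dividing `a * w`, `b * w` and `c * w` divides
-- `w`.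
expand-unit : ∀ a b c → a + c ≡ 1 + 2 * b → ∀ w → a * w + c * w ≡ 2 * b * w + w
expand-unit a b c unit w = begin
  a * w + c * w     ≡⟨ *-distribʳ-+ w a c ⟨
  (a + c) * w       ≡⟨ cong (_* w) unit ⟩
  (1 + 2 * b) * w   ≡⟨ +-comm w _ ⟩
  2 * b * w + w     ∎
  where open ≡-Reasoning

-- a is a unit modulo every common divisor m of b and c.
module _ {m a b c : ℕ} (m∣b : m ∣ b) (m∣c : m ∣ c) (a+c≡1+2b : a + c ≡ 1 + 2 * b) where

  ∣-cancel-unit : ∀ {w} → m ∣ a * w → m ∣ w
  ∣-cancel-unit {w} m∣aw = ∣m+n∣m⇒∣n
    (subst (m ∣_) (expand-unit a b c a+c≡1+2b w) (∣m∣n⇒∣m+n m∣aw (∣m⇒∣m*n w m∣c)))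
    (∣m⇒∣m*n w (∣n⇒∣m*n 2 m∣b))

  -- Modulo `m` both `b` and `c` vanish and `a` is 1, so the equation reduces to e + x ≡ N ≡ x.
  ∣-remainder : ∀ {e N x z} k → e + (a * x + c * z) ≡ N + b → N ≡ x + k * m → m ∣ e
  ∣-remainder {e} {N} {x} {z} k eq refl = ∣m+n∣m⇒∣n (subst (m ∣_) eq′ m∣lhs) m∣2bx+cz
    where
    open ≡-Reasoning
    m∣lhs : m ∣ k * m + b + c * x
    m∣lhs = ∣m∣n⇒∣m+n (∣m∣n⇒∣m+n (n∣m*n k) m∣b) (∣m⇒∣m*n x m∣c)
    m∣2bx+cz : m ∣ 2 * b * x + c * z
    m∣2bx+cz = ∣m∣n⇒∣m+n (∣m⇒∣m*n x (∣n⇒∣m*n 2 m∣b)) (∣m⇒∣m*n z m∣c)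
    eq′ : k * m + b + c * x ≡ 2 * b * x + c * z + e
    -- Adding `c * x` completes `a * x` to `(a + c) * x`, which is `x` plus a multiple of `b`; then
    -- `x` cancels.
    eq′ = +-cancelˡ-≡ x _ _ (begin
      x + (k * m + b + c * x)           ≡⟨ solve (x ∷ k ∷ m ∷ b ∷ c ∷ []) ⟩
      x + k * m + b + c * x             ≡⟨ cong (_+ c * x) eq ⟨
      e + (a * x + c * z) + c * x       ≡⟨ solve (e ∷ a ∷ x ∷ c ∷ z ∷ []) ⟩
      (a + c) * x + (c * z + e)         ≡⟨ cong (λ v → v * x + (c * z + e)) a+c≡1+2b ⟩
      (1 + 2 * b) * x + (c * z + e)     ≡⟨ solve (b ∷ x ∷ c ∷ z ∷ e ∷ []) ⟩
      x + (2 * b * x + c * z + e)       ∎)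

-- Solution counts at G and above G.

module Glued (r s p u : ℕ) .{{_ : NonZero r}} .{{_ : NonZero s}} .{{_ : NonZero p}} .{{_ : NonZero u}}
             (unit : r * s + p * u ≡ 1 + 2 * (p * s)) where

  a b c : ℕ
  a = r * s
  b = p * s
  c = p * u

  instance
    a≢0 : NonZero a
    a≢0 = m*n≢0 r s
    b≢0 : NonZero b
    b≢0 = m*n≢0 p s
    c≢0 : NonZero c
    c≢0 = m*n≢0 p u

  p∣b : p ∣ b
  p∣b = m∣m*n s
  p∣c : p ∣ c
  p∣c = m∣m*n u
  s∣a : s ∣ a
  s∣a = n∣m*n r
  s∣b : s ∣ b
  s∣b = n∣m*n p

  -- Exchanging `a` and `c` makes the divisibility lemmas available with `s` in the role of `p`.
  unit′ : c + a ≡ 1 + 2 * b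
  unit′ = trans (+-comm c a) unit

  -- Coprimality of `p` and `s` in the form required: `a * e` and `c * e` are multiples of p s = b,
  -- hence so is e = (a + c) e - 2 b e.
  b∣ : ∀ {e} → p ∣ e → s ∣ e → b ∣ e
  b∣ {e} p∣e s∣e = ∣m+n∣m⇒∣n
    (subst (b ∣_) (expand-unit a b c unit e) (∣m∣n⇒∣m+n b∣ae b∣ce))
    (∣m⇒∣m*n e (n∣m*n 2))
    where
    b∣ae : b ∣ a * e
    b∣ae = subst (_∣ a * e) (*-comm s p) (*-pres-∣ s∣a p∣e)
    b∣ce : b ∣ c * e
    b∣ce = *-pres-∣ p∣c s∣e

  -- Since a p = b r and c s = b u, the equation on `G` says G = a (p - 1) + b (Z - 1) + c (s - 1),
  -- with the subtractions moved across.
  module _ {Z q G : ℕ} (jump : Jump r u Z q) (G-def : G + a + c + b ≡ b * (r + u + Z)) where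
    open Jump jump

    -- The solutions of `G`: x₀ = p - 1, y₀ = Z - 1 and z₀ = s - 1, so x + 1 and z + 1 are multiples
    -- of `p` and `s`.
    index : ℕ × ℕ → ℕ × ℕ × ℕ
    index (i , j) = (suc i * p ∸ 1 , Z ∸ suc (r * i + u * j) , suc j * s ∸ 1)

    -- After adding 1 to each coordinate the right side becomes a multiple of `b`. Reducing modulo
    -- `p` and modulo `s` then forces p to divide x + 1 and s to divide z + 1.
    solution-index : ∀ x y z → IsSolution G a b c (x , y , z) → (x , y , z) ∈ map index below
    solution-index x y z sol = go
      (∣-cancel-unit p∣b p∣c unit {suc x} (∣m+n∣m⇒∣n
        (subst (p ∣_) (sym eqx) (∣m⇒∣m*n _ p∣b))
        (∣m∣n⇒∣m+n (∣m⇒∣m*n (suc y) p∣b) (∣m⇒∣m*n (suc z) p∣c))))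
      (∣-cancel-unit s∣b s∣a unit′ {suc z} (∣m+n∣m⇒∣n
        (subst (s ∣_) (sym eqz) (∣m⇒∣m*n _ s∣b))
        (∣m∣n⇒∣m+n (∣m⇒∣m*n (suc y) s∣b) (∣m⇒∣m*n (suc x) s∣a))))
      where
      open ≡-Reasoning
      shifted : ∀ a b c → a * suc x + b * suc y + c * suc z ≡ (a * x + b * y + c * z) + a + c + b
      shifted a b c = solve (a ∷ b ∷ c ∷ x ∷ y ∷ z ∷ [])
      eq : a * suc x + b * suc y + c * suc z ≡ b * (r + u + Z)
      eq = trans (shifted a b c) (trans (cong (λ v → v + a + c + b) sol) G-def)
      eqx : b * suc y + c * suc z + a * suc x ≡ b * (r + u + Z)
      eqx = trans (trans (+-comm (b * suc y + c * suc z) (a * suc x)) (sym (+-assoc (a * suc x) _ _))) eq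
      eqz : b * suc y + a * suc x + c * suc z ≡ b * (r + u + Z)
      eqz = trans (cong (_+ c * suc z) (+-comm (b * suc y) (a * suc x))) eq
      go : p ∣ suc x → s ∣ suc z → (x , y , z) ∈ map index below
      go (divides (suc i) ex) (divides (suc j) ez) =
        subst (_∈ map index below)
          (cong₂ _,_ (cong (_∸ 1) (sym ex)) (cong₂ _,_ y-eq (cong (_∸ 1) (sym ez))))
          (∈-map⁺ index (below-complete i j (m+n≤o⇒m≤o (suc w) (≤-reflexive Z-eq))))
        where
        w = r * i + u * j
        expand : ∀ i j → p * s * (r * suc i + suc y + u * suc j) ≡
                 r * s * (suc i * p) + p * s * suc y + p * u * (suc j * s)
        expand i j = solve (r ∷ s ∷ p ∷ u ∷ i ∷ j ∷ y ∷ [])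
        cancelled : r * suc i + suc y + u * suc j ≡ r + u + Z
        -- Every term now carries the factor `b`; dividing by it leaves w + 1 + y = Z, whence w < Z.
        cancelled = *-cancelˡ-≡ _ _ b (begin
          b * (r * suc i + suc y + u * suc j)                     ≡⟨ expand i j ⟩
          a * (suc i * p) + b * suc y + c * (suc j * s)           ≡⟨ cong₂ (λ v v′ → a * v + b * suc y + c * v′) ex ez ⟨
          a * suc x + b * suc y + c * suc z                       ≡⟨ eq ⟩
          b * (r + u + Z)                                         ∎)
        Z-eq : suc w + y ≡ Z
        Z-eq = +-cancelˡ-≡ (r + u) _ _ (trans (rearrange i j) cancelled)
          where
          rearrange : ∀ i j → r + u + (suc (r * i + u * j) + y) ≡ r * suc i + suc y + u * suc j
          rearrange i j = solve (r ∷ u ∷ i ∷ j ∷ y ∷ [])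
        y-eq : Z ∸ suc w ≡ y
        y-eq = trans (cong (_∸ suc w) (sym Z-eq)) (m+n∸m≡n (suc w) y)

    d-upper : d G a b c ≤ q
    d-upper = begin
      d G a b c                     ≡⟨ length-solutions G a b c ⟨
      length (solutions G a b c)    ≤⟨ unique-⊆⇒length-≤ (unique-solutions G a b c) sub ⟩
      length (map index below)      ≡⟨ length-map index below ⟩
      length below                  ≤⟨ below-length ⟩
      q                             ∎
      where
      open ≤-Reasoning
      sub : solutions G a b c ⊆ map index below
      sub {x , y , z} v∈ = solution-index x y z (proj₂ (∈-filter⁻ (isSolution? G a b c) {xs = triples (suc G)} v∈))

    d-lower : ∀ N → G < N → q < d N a b c
    -- The excess is b (y₀ + 1): the added `b` matches the strict bound b Z < e with Z ≤ y₀.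
    d-lower N G<N = from-excess
      (N + b ∸ base) (sym (m∸n+n≡m (<⇒≤ (≤-<-trans (m≤m+n base (b * Z)) excess))))
      where
      -- As a ≡ 1 modulo `p` and c ≡ 1 modulo `s`, the coordinates x and z of any solution have the
      -- residues of `N`.
      x₀ = N % p
      z₀ = N % s
      base = a * x₀ + c * z₀

      -- From x₀ + 1 ≤ p and z₀ + 1 ≤ s, a + c + base is at most a p + c s = b (r + u); the rest is
      -- G < N.
      excess : base + b * Z < N + b
      excess = +-cancelˡ-< (a + c) _ _ (begin-strict
        a + c + (base + b * Z)                 ≡⟨ gather a c x₀ z₀ (b * Z) ⟩
        a * suc x₀ + c * suc z₀ + b * Z         ≤⟨ +-monoˡ-≤ (b * Z)
                                                      (+-mono-≤ (*-monoʳ-≤ a (m%n<n N p)) (*-monoʳ-≤ c (m%n<n N s))) ⟩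
        r * s * p + p * u * s + p * s * Z       ≡⟨ solve (r ∷ s ∷ p ∷ u ∷ Z ∷ []) ⟩
        p * s * (r + u + Z)                     ≡⟨ G-def ⟨
        G + a + c + b                           <⟨ +-monoˡ-< b (+-monoˡ-< c (+-monoˡ-< a G<N)) ⟩
        N + a + c + b                           ≡⟨ swap-out N a c b ⟩
        a + c + (N + b)                         ∎)
        where
        open ≤-Reasoning
        gather : ∀ a c x z v → a + c + (a * x + c * z + v) ≡ a * suc x + c * suc z + v
        gather = solve-∀
        swap-out : ∀ N a c b → N + a + c + b ≡ a + c + (N + b)
        swap-out = solve-∀

      from-excess : ∀ e → N + b ≡ e + base → q < d N a b c
      from-excess e e-def = go (b∣ p∣e s∣e)
        where
        p∣e : p ∣ e
        p∣e = ∣-remainder p∣b p∣c unit (N / p) (sym e-def) (m≡m%n+[m/n]*n N p)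
        s∣e : s ∣ e
        s∣e = ∣-remainder s∣b s∣a unit′ (N / s)
          (trans (cong (e +_) (+-comm (c * z₀) (a * x₀))) (sym e-def)) (m≡m%n+[m/n]*n N s)
        bZ<e : b * Z < e
        bZ<e = +-cancelˡ-< base _ _ (<-≤-trans excess (≤-reflexive (trans e-def (+-comm e base))))
        go : b ∣ e → q < d N a b c
        go (divides zero refl) = contradiction bZ<e (λ ())
        go (divides (suc y₀) refl) = begin
          suc q                         ≤⟨ upto-length ⟩
          length upto                   ≡⟨ length-map at upto ⟨
          length (map at upto)          ≤⟨ unique-⊆⇒length-≤ (map⁺ at-injective upto-unique) at⊆ ⟩
          length (solutions N a b c)    ≡⟨ length-solutions N a b c ⟩
          d N a b c                     ∎
          where
          Z≤y₀ : Z ≤ y₀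
          Z≤y₀ = s≤s⁻¹ (*-cancelˡ-< b _ _ (<-≤-trans bZ<e (≤-reflexive (*-comm (suc y₀) b))))
          at : ℕ × ℕ → ℕ × ℕ × ℕ
          at (i , j) = (x₀ + p * i , y₀ ∸ (r * i + u * j) , z₀ + s * j)
          at-injective : ∀ {v v′} → at v ≡ at v′ → v ≡ v′
          at-injective {i , j} {i′ , j′} eq = cong₂ _,_
            (*-cancelˡ-≡ i i′ p (+-cancelˡ-≡ x₀ _ _ (cong proj₁ eq)))
            (*-cancelˡ-≡ j j′ s (+-cancelˡ-≡ z₀ _ _ (cong (proj₂ ∘ proj₂) eq)))
          at-solution : ∀ i j → r * i + u * j ≤ y₀ → IsSolution N a b c (at (i , j))
          at-solution i j w≤y₀ = +-cancelʳ-≡ b _ _ (begin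
            a * (x₀ + p * i) + b * v + c * (z₀ + s * j) + b   ≡⟨ expand r s p u x₀ z₀ i j v ⟩
            suc (r * i + u * j + v) * b + base                ≡⟨ cong (λ y → suc y * b + base) (m+[n∸m]≡n w≤y₀) ⟩
            suc y₀ * b + base                                 ≡⟨ e-def ⟨
            N + b                                             ∎)
            where
            open ≡-Reasoning
            v = y₀ ∸ (r * i + u * j)
            expand : ∀ r s p u x z i j v →
              r * s * (x + p * i) + p * s * v + p * u * (z + s * j) + p * s ≡
              suc (r * i + u * j + v) * (p * s) + (r * s * x + p * u * z)
            expand = solve-∀
          at⊆ : map at upto ⊆ solutions N a b c
          at⊆ v∈ with (i , j) , ij∈ , refl ← ∈-map⁻ at v∈ =
            ∈-solutions⁺ N a b c (at-solution i j (≤-trans (upto-sound ij∈) Z≤y₀))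
          open ≤-Reasoning

    isG : IsG a b c q G
    isG = d-upper , d-lower

-- Deciding jumps for linear forms.

-- (α , β) stands for the linear form α k + β.
Form : Set
Form = ℕ × ℕ

⟦_⟧ : Form → ℕ → ℕ
⟦ α , β ⟧ k = α * k + β

combine : Form → Form → ℕ → ℕ → Form
combine (α , β) (γ , δ) i j = α * i + γ * j , β * i + δ * j

⟦combine⟧ : ∀ R U i j k → ⟦ combine R U i j ⟧ k ≡ ⟦ R ⟧ k * i + ⟦ U ⟧ k * j
⟦combine⟧ (α , β) (γ , δ) i j k = regroup α β γ δ i j k
  where
  regroup : ∀ α β γ δ i j k → (α * i + γ * j) * k + (β * i + δ * j) ≡ (α * k + β) * i + (γ * k + δ) * j
  regroup = solve-∀

-- A decidable sufficient condition for F ≤ F′ at all k ≥ κ: the gap at `κ` is nonnegative and does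
-- not shrink.
Dominated : ℕ → Form → Form → Set
Dominated κ F@(α , _) F′@(α′ , _) = α ≤ α′ × ⟦ F ⟧ κ ≤ ⟦ F′ ⟧ κ

dominated? : ∀ κ F F′ → Dec (Dominated κ F F′)
dominated? κ F@(α , _) F′@(α′ , _) = α ≤? α′ ×-dec ⟦ F ⟧ κ ≤? ⟦ F′ ⟧ κ

dominated⇒≤ : ∀ {κ k} F F′ → κ ≤ k → Dominated κ F F′ → ⟦ F ⟧ k ≤ ⟦ F′ ⟧ k
dominated⇒≤ {κ} {k} (α , β) (α′ , β′) κ≤k (α≤α′ , le)
  with m≤n⇒∃[o]m+o≡n κ≤k
... | e , refl = begin
  α * (κ + e) + β           ≡⟨ split α β ⟩
  (α * κ + β) + α * e       ≤⟨ +-mono-≤ le (*-monoˡ-≤ e α≤α′) ⟩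
  (α′ * κ + β′) + α′ * e    ≡⟨ split α′ β′ ⟨
  α′ * (κ + e) + β′         ∎
  where
  open ≤-Reasoning
  split : ∀ α β → α * (κ + e) + β ≡ (α * κ + β) + α * e
  split α β = solve (α ∷ β ∷ κ ∷ e ∷ [])

-- Large enough for the first component of JumpCheck to hold in all cases.
side : ℕ
side = 7

box : List (ℕ × ℕ)
box = cartesianProduct (upTo side) (upTo side)

module _ (κ : ℕ) (R U Z : Form) where

  NotBelow : ℕ × ℕ → Set
  NotBelow (i , j) = Dominated κ Z (combine R U i j)

  notBelow? : Decidable NotBelow
  notBelow? (i , j) = dominated? κ Z (combine R U i j)

  Upto : ℕ × ℕ → Set
  Upto (i , j) = Dominated κ (combine R U i j) Z

  upto? : Decidable Upto
  upto? (i , j) = dominated? κ (combine R U i j) Z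

  -- The first component keeps the pairs of weight below `Z` inside the box, weights being monotone
  -- in `i` and `j`; the other two count inside it.
  JumpCheck : ℕ → Set
  JumpCheck q = (NotBelow (side , 0) × NotBelow (0 , side))
              × length (filter (¬? ∘ notBelow?) box) ≤ q
              × q < length (filter upto? box)

  jumpCheck? : ∀ q → Dec (JumpCheck q)
  jumpCheck? q = (notBelow? (side , 0) ×-dec notBelow? (0 , side))
           ×-dec length (filter (¬? ∘ notBelow?) box) ≤? q
           ×-dec q <? length (filter upto? box)

  -- `Dominated` is only sufficient, so `below` may be too large and `upto` too small; these are the
  -- directions that `Jump` tolerates.
  jumpCheck⇒Jump : ∀ {q k} → κ ≤ k → JumpCheck q → Jump (⟦ R ⟧ k) (⟦ U ⟧ k) (⟦ Z ⟧ k) q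
  jumpCheck⇒Jump {q} {k} κ≤k ((side-i , side-j) , below-length , upto-length) = record
    { below          = filter (¬? ∘ notBelow?) box
    ; below-complete = below-complete
    ; below-length   = below-length
    ; upto           = filter upto? box
    ; upto-unique    = filter⁺ upto? (cartesianProduct⁺ (upTo⁺ side) (upTo⁺ side))
    ; upto-sound     = upto-sound
    ; upto-length    = upto-length
    }
    where
    open ≤-Reasoning
    r = ⟦ R ⟧ k
    u = ⟦ U ⟧ k
    notBelow⇒≤ : ∀ {i j} → NotBelow (i , j) → ⟦ Z ⟧ k ≤ r * i + u * j
    notBelow⇒≤ {i} {j} nb = ≤-trans (dominated⇒≤ Z (combine R U i j) κ≤k nb) (≤-reflexive (⟦combine⟧ R U i j k))
    below-complete : ∀ i j → r * i + u * j < ⟦ Z ⟧ k → (i , j) ∈ filter (¬? ∘ notBelow?) box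
    below-complete i j lt = ∈-filter⁺ (¬? ∘ notBelow?)
      (∈-cartesianProduct⁺ (∈-upTo⁺ (≰⇒> i≱side)) (∈-upTo⁺ (≰⇒> j≱side)))
      (λ nb → <⇒≱ lt (notBelow⇒≤ nb))
      where
      i≱side : ¬ side ≤ i
      i≱side side≤i = <⇒≱ lt (begin
        ⟦ Z ⟧ k                 ≤⟨ notBelow⇒≤ side-i ⟩
        r * side + u * 0        ≤⟨ +-mono-≤ (*-monoʳ-≤ r side≤i) (*-monoʳ-≤ u z≤n) ⟩
        r * i + u * j           ∎)
      j≱side : ¬ side ≤ j
      j≱side side≤j = <⇒≱ lt (begin
        ⟦ Z ⟧ k                 ≤⟨ notBelow⇒≤ side-j ⟩
        r * 0 + u * side        ≤⟨ +-mono-≤ (*-monoʳ-≤ r z≤n) (*-monoʳ-≤ u side≤j) ⟩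
        r * i + u * j           ∎)
    upto-sound : ∀ {i j} → (i , j) ∈ filter upto? box → r * i + u * j ≤ ⟦ Z ⟧ k
    upto-sound {i} {j} ij∈ = ≤-trans (≤-reflexive (sym (⟦combine⟧ R U i j k)))
      (dominated⇒≤ (combine R U i j) Z κ≤k (proj₂ (∈-filter⁻ upto? {xs = box} ij∈)))

-- Forms of slope 0 give the purely numerical check for a single n.
constant-jump : ∀ r u Z q {_ : True (jumpCheck? 0 (0 , r) (0 , u) (0 , Z) q)} → Jump r u Z q
constant-jump r u Z q {check} = jumpCheck⇒Jump 0 (0 , r) (0 , u) (0 , Z) {k = 0} z≤n (toWitness check)

-- Triangular numbers in each parity.

t-half : ∀ m v → m * suc m ≡ v * 2 → t m ≡ v
t-half m v eq = trans (cong (_/ 2) eq) (m*n/n≡m v 2)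

-- The relation turns a + c + b into 1 + 3 b, which absorbs the - 1 and adds 3 to the factor `v`.
-- Nonzero `b` and `v` make the truncated subtraction exact.
largest : ∀ b {a c w v} .{{_ : NonZero b}} .{{_ : NonZero v}} → a + c ≡ 1 + 2 * b → 3 + v ≡ w →
  (b * v ∸ 1) + a + c + b ≡ b * w
largest b {a} {c} {w} {v} unit refl = begin
  (b * v ∸ 1) + a + c + b           ≡⟨ assoc (b * v ∸ 1) a c b ⟩
  (b * v ∸ 1) + (a + c) + b         ≡⟨ cong (λ x → (b * v ∸ 1) + x + b) unit ⟩
  (b * v ∸ 1) + (1 + 2 * b) + b     ≡⟨ regroup (b * v ∸ 1) b ⟩
  (b * v ∸ 1 + 1) + 3 * b           ≡⟨ cong (_+ 3 * b) (m∸n+n≡m (>-nonZero⁻¹ (b * v) {{m*n≢0 b v}})) ⟩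
  b * v + 3 * b                     ≡⟨ solve (b ∷ v ∷ []) ⟩
  b * (3 + v)                       ∎
  where
  open ≡-Reasoning
  assoc : ∀ g a c b → g + a + c + b ≡ g + (a + c) + b
  assoc = solve-∀
  regroup : ∀ g b → g + (1 + 2 * b) + b ≡ (g + 1) + 3 * b
  regroup = solve-∀

-- In both parities r + u = 3 k + 3, so 3 k + Z is the factor `v` of `largest`.
3k+Z≢0 : ∀ k Z .{{_ : NonZero k}} → NonZero (3 * k + Z)
3k+Z≢0 k Z = >-nonZero (≤-trans (>-nonZero⁻¹ (3 * k) {{m*n≢0 3 k}}) (m≤m+n (3 * k) Z))

isG⇒gT : ∀ n {a b c q G} → t n ≡ a → t (suc n) ≡ b → t (suc (suc n)) ≡ c → IsG a b c q G → gT n q G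
isG⇒gT n refl refl refl isG = isG

gT-even : ∀ k {Z q G} .{{_ : NonZero k}} → Jump (⟦ 1 , 0 ⟧ k) (⟦ 2 , 3 ⟧ k) Z q →
  G ≡ suc k * suc (2 * k) * (3 * k + Z) ∸ 1 → gT (k * 2) q G
gT-even k {Z} {q} jump refl = isG⇒gT (k * 2) a-eq b-eq c-eq
  (Glued.isG k (suc (2 * k)) (suc k) (3 + 2 * k) unit
    (subst₂ (λ r u → Jump r u Z q) r-eq (+-comm (2 * k) 3) jump)
    (largest (suc k * suc (2 * k)) {{_}} {{3k+Z≢0 k Z}} unit (solve (k ∷ Z ∷ []))))
  where
  a-eq : t (k * 2) ≡ k * suc (2 * k)
  a-eq = t-half (k * 2) (k * suc (2 * k)) (solve (k ∷ []))
  b-eq : t (suc (k * 2)) ≡ suc k * suc (2 * k)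
  b-eq = t-half (suc (k * 2)) (suc k * suc (2 * k)) (solve (k ∷ []))
  c-eq : t (suc (suc (k * 2))) ≡ suc k * (3 + 2 * k)
  c-eq = t-half (suc (suc (k * 2))) (suc k * (3 + 2 * k)) (solve (k ∷ []))
  unit : k * suc (2 * k) + suc k * (3 + 2 * k) ≡ 1 + 2 * (suc k * suc (2 * k))
  unit = solve (k ∷ [])
  r-eq : 1 * k + 0 ≡ k
  r-eq = solve (k ∷ [])

gT-odd : ∀ k {Z q G} .{{_ : NonZero k}} → Jump (⟦ 2 , 1 ⟧ k) (⟦ 1 , 2 ⟧ k) Z q →
  G ≡ (3 + 2 * k) * suc k * (3 * k + Z) ∸ 1 → gT (1 + k * 2) q G
gT-odd k {Z} {q} jump refl = isG⇒gT (1 + k * 2) a-eq b-eq c-eq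
  (Glued.isG (suc (2 * k)) (suc k) (3 + 2 * k) (2 + k) unit
    (subst₂ (λ r u → Jump r u Z q) (+-comm (2 * k) 1) u-eq jump)
    (largest ((3 + 2 * k) * suc k) {{_}} {{3k+Z≢0 k Z}} unit (solve (k ∷ Z ∷ []))))
  where
  a-eq : t (1 + k * 2) ≡ suc (2 * k) * suc k
  a-eq = t-half (1 + k * 2) (suc (2 * k) * suc k) (solve (k ∷ []))
  b-eq : t (suc (1 + k * 2)) ≡ (3 + 2 * k) * suc k
  b-eq = t-half (suc (1 + k * 2)) ((3 + 2 * k) * suc k) (solve (k ∷ []))
  c-eq : t (suc (suc (1 + k * 2))) ≡ (3 + 2 * k) * (2 + k)
  c-eq = t-half (suc (suc (1 + k * 2))) ((3 + 2 * k) * (2 + k)) (solve (k ∷ []))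
  unit : suc (2 * k) * suc k + (3 + 2 * k) * (2 + k) ≡ 1 + 2 * ((3 + 2 * k) * suc k)
  unit = solve (k ∷ [])
  u-eq : 1 * k + 2 ≡ 2 + k
  u-eq = solve (k ∷ [])

-- Uniform families in n and isolated values.

-- The slack of 1 lets a bound on n of either parity yield a bound on k.
half-≤ : ∀ κ k → κ * 2 ≤ suc (k * 2) → κ ≤ k
half-≤ κ k le = s≤s⁻¹ (*-cancelʳ-< 2 κ (suc k) (s≤s le))

quotient-eq : ∀ m y {x} .{{_ : NonZero m}} → x ≡ y * m → x / m ∸ 1 ≡ y ∸ 1
quotient-eq m y refl = cong (_∸ 1) (m*n/n≡m y m)

-- The threshold Z is ζ k + ζ′, valid for k ≥ κ; D is the denominator in the formula for G.
gT-evens : ∀ c κ ζ ζ′ q D .{{_ : NonZero D}}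
  {_ : True (κ * 2 ≤? suc c)} {_ : True (jumpCheck? κ (1 , 0) (2 , 3) (ζ , ζ′) q)}
  .{{_ : NonZero κ}} (X : ℕ → ℕ) →
  (∀ k → X (k * 2) ≡ suc k * suc (2 * k) * (3 * k + (ζ * k + ζ′)) * D) →
  ∀ n → c ≤ n → n % 2 ≡ 0 → gT n q (X n / D ∸ 1)
gT-evens c κ ζ ζ′ q D {κ≤c} {check} X X-eq n c≤n n%2 = subst (λ n → gT n q (X n / D ∸ 1)) (sym n≡)
  (gT-even k {{>-nonZero (≤-trans (>-nonZero⁻¹ κ) κ≤k)}}
    (jumpCheck⇒Jump κ (1 , 0) (2 , 3) (ζ , ζ′) κ≤k (toWitness check))
    (quotient-eq D (suc k * suc (2 * k) * (3 * k + (ζ * k + ζ′))) (X-eq k)))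
  where
  k = n / 2
  n≡ : n ≡ k * 2
  n≡ = trans (m≡m%n+[m/n]*n n 2) (cong (_+ k * 2) n%2)
  κ≤k : κ ≤ k
  κ≤k = half-≤ κ k (≤-trans (toWitness κ≤c) (s≤s (≤-trans c≤n (≤-reflexive n≡))))

gT-odds : ∀ c κ ζ ζ′ q D .{{_ : NonZero D}}
  {_ : True (κ * 2 ≤? c)} {_ : True (jumpCheck? κ (2 , 1) (1 , 2) (ζ , ζ′) q)}
  .{{_ : NonZero κ}} (X : ℕ → ℕ) →
  (∀ k → X (1 + k * 2) ≡ (3 + 2 * k) * suc k * (3 * k + (ζ * k + ζ′)) * D) →
  ∀ n → c ≤ n → n % 2 ≡ 1 → gT n q (X n / D ∸ 1)
gT-odds c κ ζ ζ′ q D {κ≤c} {check} X X-eq n c≤n n%2 = subst (λ n → gT n q (X n / D ∸ 1)) (sym n≡)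
  (gT-odd k {{>-nonZero (≤-trans (>-nonZero⁻¹ κ) κ≤k)}}
    (jumpCheck⇒Jump κ (2 , 1) (1 , 2) (ζ , ζ′) κ≤k (toWitness check))
    (quotient-eq D ((3 + 2 * k) * suc k * (3 * k + (ζ * k + ζ′))) (X-eq k)))
  where
  k = n / 2
  n≡ : n ≡ 1 + k * 2
  n≡ = trans (m≡m%n+[m/n]*n n 2) (cong (_+ k * 2) n%2)
  κ≤k : κ ≤ k
  κ≤k = half-≤ κ k (≤-trans (toWitness κ≤c) (≤-trans c≤n (≤-reflexive n≡)))

by-parity : ∀ {P : ℕ → Set} c → (∀ n → c ≤ n → n % 2 ≡ 1 → P n) → (∀ n → c ≤ n → n % 2 ≡ 0 → P n) →
  ∀ n → c ≤ n → P n
by-parity c odds evens n c≤n with n % 2 in eq | m%n<n n 2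
... | 0 | _ = evens n c≤n eq
... | 1 | _ = odds n c≤n eq
... | suc (suc _) | s≤s (s≤s ())

-- For isolated n below a uniform range: a numerical threshold replaces the linear form.
gT-even-at : ∀ κ Z q D .{{_ : NonZero D}} .{{_ : NonZero κ}} → Jump (⟦ 1 , 0 ⟧ κ) (⟦ 2 , 3 ⟧ κ) Z q →
  (X : ℕ → ℕ) → X (κ * 2) ≡ suc κ * suc (2 * κ) * (3 * κ + Z) * D →
  ∀ n → n ≡ κ * 2 → gT n q (X n / D ∸ 1)
gT-even-at κ Z q D jump X X-eq n refl =
  gT-even κ jump (quotient-eq D (suc κ * suc (2 * κ) * (3 * κ + Z)) X-eq)

gT-odd-at : ∀ κ Z q D .{{_ : NonZero D}} .{{_ : NonZero κ}} → Jump (⟦ 2 , 1 ⟧ κ) (⟦ 1 , 2 ⟧ κ) Z q →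
  (X : ℕ → ℕ) → X (1 + κ * 2) ≡ (3 + 2 * κ) * suc κ * (3 * κ + Z) * D →
  ∀ n → n ≡ 1 + κ * 2 → gT n q (X n / D ∸ 1)
gT-odd-at κ Z q D jump X X-eq n refl =
  gT-odd κ jump (quotient-eq D ((3 + 2 * κ) * suc κ * (3 * κ + Z)) X-eq)

-- The eight families of values.

theorem4 : ((∀ n → 3 ≤ n → n % 2 ≡ 1 → gT n 3 ((5 * n + 3) * (n + 1) * (n + 2) / 4 ∸ 1))
    × (∀ n → 6 ≤ n → n % 2 ≡ 0 → gT n 3 ((5 * n + 6) * (n + 1) * (n + 2) / 4 ∸ 1)))
    × (∀ n → (n ≡ 5 ⊎ 7 ≤ n) → gT n 4 (3 * n * (n + 1) * (n + 2) / 2 ∸ 1))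
    × (∀ n → (n ≡ 6 ⊎ 8 ≤ n) → gT n 5 (3 * (n + 1) * (n + 1) * (n + 2) / 2 ∸ 1))
    × ((∀ n → 11 ≤ n → n % 2 ≡ 1 → gT n 6 ((7 * n ∸ 3) * (n + 1) * (n + 2) / 4 ∸ 1))
    × (∀ n → 8 ≤ n → n % 2 ≡ 0 → gT n 6 (7 * n * (n + 1) * (n + 2) / 4 ∸ 1)))
    × ((∀ n → 5 ≤ n → n % 2 ≡ 1 → gT n 7 ((7 * n + 3) * (n + 1) * (n + 2) / 4 ∸ 1))
    × (∀ n → 6 ≤ n → n % 2 ≡ 0 → gT n 7 ((7 * n + 6) * (n + 1) * (n + 2) / 4 ∸ 1)))
    × ((∀ n → 9 ≤ n → n % 2 ≡ 1 → gT n 8 ((7 * n + 9) * (n + 1) * (n + 2) / 4 ∸ 1))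
    × (∀ n → 12 ≤ n → n % 2 ≡ 0 → gT n 8 ((7 * n + 12) * (n + 1) * (n + 2) / 4 ∸ 1)))
    × (∀ n → (n ≡ 11 ⊎ 13 ≤ n) → gT n 9 (2 * n * (n + 1) * (n + 2) ∸ 1))
    × (∀ n → (n ≡ 3 ⊎ n ≡ 4 ⊎ 8 ≤ n) → gT n 10 ((4 * n + 3) * (n + 1) * (n + 2) / 2 ∸ 1))
theorem4 =
    -- The form ζ k + ζ′ is (G + 1) / b minus 3 k. Each such threshold is itself a weight r i + u j:
    -- here 2 k + 4 = 2 u for odd n, and 2 k + 3 = u for even n.
    ( gT-odds  3 1 2 4 3 4 (λ n → (5 * n + 3) * (n + 1) * (n + 2)) (λ k → solve (k ∷ []))
    , gT-evens 6 3 2 3 3 4 (λ n → (5 * n + 6) * (n + 1) * (n + 2)) (λ k → solve (k ∷ [])))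
  -- For n = 5: k = 2, r = 5, u = 4 and Z = r + u = 9.
  , (λ n → [ gT-odd-at 2 9 4 2 (constant-jump 5 4 9 4) (λ n → 3 * n * (n + 1) * (n + 2)) refl n
           , by-parity 7
               (gT-odds  7 3 3 3 4 2 (λ n → 3 * n * (n + 1) * (n + 2)) (λ k → solve (k ∷ [])))
               (gT-evens 7 4 3 0 4 2 (λ n → 3 * n * (n + 1) * (n + 2)) (λ k → solve (k ∷ []))) n ]′)
  , (λ n → [ gT-even-at 3 12 5 2 (constant-jump 3 9 12 5) (λ n → 3 * (n + 1) * (n + 1) * (n + 2)) refl n
           , by-parity 8
               (gT-odds  8 4 3 6 5 2 (λ n → 3 * (n + 1) * (n + 1) * (n + 2)) (λ k → solve (k ∷ [])))
               (gT-evens 8 4 3 3 5 2 (λ n → 3 * (n + 1) * (n + 1) * (n + 2)) (λ k → solve (k ∷ []))) n ]′)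
  , ( gT-odds 11 5 4 2 6 4 (λ n → (7 * n ∸ 3) * (n + 1) * (n + 2))
        -- The truncated 7 n ∸ 3 is first replaced by 14 k + 4, which leaves a semiring identity.
        (λ k → trans (cong (λ m → m * (1 + k * 2 + 1) * (1 + k * 2 + 2)) (7n∸3 k)) (solve (k ∷ [])))
    , gT-evens 8 4 4 0 6 4 (λ n → 7 * n * (n + 1) * (n + 2)) (λ k → solve (k ∷ [])))
  , ( gT-odds  5 2 4 5 7 4 (λ n → (7 * n + 3) * (n + 1) * (n + 2)) (λ k → solve (k ∷ []))
    , gT-evens 6 3 4 3 7 4 (λ n → (7 * n + 6) * (n + 1) * (n + 2)) (λ k → solve (k ∷ [])))
  , ( gT-odds   9 4 4 8 8 4 (λ n → (7 * n + 9) * (n + 1) * (n + 2)) (λ k → solve (k ∷ []))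
    , gT-evens 12 6 4 6 8 4 (λ n → (7 * n + 12) * (n + 1) * (n + 2)) (λ k → solve (k ∷ [])))
  -- This formula has no denominator: D = 1, and the quotient by 1 is then removed.
  , (λ n h → subst (λ G → gT n 9 (G ∸ 1)) (n/1≡n (2 * n * (n + 1) * (n + 2)))
      ([ gT-odd-at 5 29 9 1 (constant-jump 11 7 29 9) (λ n → 2 * n * (n + 1) * (n + 2)) refl n
       , by-parity 13
           (gT-odds  13 6 5 4 9 1 (λ n → 2 * n * (n + 1) * (n + 2)) (λ k → solve (k ∷ [])))
           (gT-evens 13 7 5 0 9 1 (λ n → 2 * n * (n + 1) * (n + 2)) (λ k → solve (k ∷ []))) n ]′ h))
  -- For n = 3, r = u = 3: the pairs of weight below 12 are the 10 pairs with i + j < 4.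
  , (λ n → [ gT-odd-at 1 12 10 2 (constant-jump 3 3 12 10) (λ n → (4 * n + 3) * (n + 1) * (n + 2)) refl n
           , [ gT-even-at 2 13 10 2 (constant-jump 2 7 13 10) (λ n → (4 * n + 3) * (n + 1) * (n + 2)) refl n
             , by-parity 8
                 (gT-odds  8 4 5 7 10 2 (λ n → (4 * n + 3) * (n + 1) * (n + 2)) (λ k → solve (k ∷ [])))
                 (gT-evens 8 4 5 3 10 2 (λ n → (4 * n + 3) * (n + 1) * (n + 2)) (λ k → solve (k ∷ []))) n ]′ ]′)
  where
  7n∸3 : ∀ k → 7 * (1 + k * 2) ∸ 3 ≡ 14 * k + 4
  7n∸3 k = trans (cong (_∸ 3) 7n) (m+n∸n≡m (14 * k + 4) 3)
    where
    7n : 7 * (1 + k * 2) ≡ 14 * k + 4 + 3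
    7n = solve (k ∷ [])
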